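{- Let $C_n$ be the cycle on $n\ge 3$ vertices and $k$ a positive integer with $k\ge\chi(C_n)$ and $n\ge k+1$. Then the strong $k$-colour graph $S_k(C_n)$ is connected if and only if $k\ge 4$, $n\ge 6$ and $n\ge k+1$.
   Context: A proper $k$-colouring of a graph $G$ is a map $V(G)\to\{1,\dots,k\}$ giving adjacent vertices different colours; it is strong if all $k$ colours appear. The strong $k$-colour graph $S_k(G)$ has the strong $k$-colourings of $G$ as vertices, two being adjacent iff they differ in colour on exactly one vertex of $G$. -}

module Defs where

open import Data.Nat using (ℕ; suc)
open import Data.Fin using (Fin; toℕ)
open import Data.Product using (Σ; ∃; _×_; _,_)
open import Data.Sum using (_⊎_)
open import Relation.Nullary using (¬_)
open import Relation.Binary.PropositionalEquality using (_≡_)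

Graph : ℕ → Set₁
Graph n = Fin n → Fin n → Set

CycSucc : (n : ℕ) → Fin n → Fin n → Set
CycSucc n i j = (suc (toℕ i) ≡ toℕ j) ⊎ ((suc (toℕ i) ≡ n) × (toℕ j ≡ 0))

Cycle : (n : ℕ) → Graph n
Cycle n i j = CycSucc n i j ⊎ CycSucc n j i

Proper : ∀ {n} → Graph n → (k : ℕ) → (Fin n → Fin k) → Set
Proper G k c = ∀ u v → G u v → ¬ (c u ≡ c v)

ChromaticAtMost : ∀ {n} → Graph n → ℕ → Set
ChromaticAtMost {n} G k = Σ (Fin n → Fin k) (Proper G k)

Strong : ∀ {n} (k : ℕ) → (Fin n → Fin k) → Set
Strong k c = ∀ (a : Fin k) → ∃ λ v → c v ≡ a

record StrongCol {n} (G : Graph n) (k : ℕ) : Set where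
  constructor mkSC
  field
    col    : Fin n → Fin k
    proper : Proper G k col
    strong : Strong k col
open StrongCol public

SAdj : ∀ {n} {G : Graph n} {k} → StrongCol G k → StrongCol G k → Set
SAdj {n} c d = ∃ λ (v : Fin n) →
  ¬ (col c v ≡ col d v) × (∀ u → ¬ (u ≡ v) → col c u ≡ col d u)

-- walks in S_k(G); colourings are compared pointwise (no funext)
data Reachable {n} {G : Graph n} {k} : StrongCol G k → StrongCol G k → Set where
  here : ∀ {c d} → (∀ v → col c v ≡ col d v) → Reachable c d
  step : ∀ {c c' d} → SAdj c c' → Reachable c' d → Reachable c d

SConnected : ∀ {n} → Graph n → ℕ → Set
SConnected G k = ∀ (c d : StrongCol G k) → Reachable c d

{-# OPTIONS --safe #-}

-- Connectedness is an induction in which vertex 0 of the cycle is deleted.  If c(0) is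
-- repeated and the two neighbours of 0 have different colours, deleting 0 leaves a strong
-- k-colouring of the shorter cycle, and with four colours every walk there lifts back.
-- If c(0) is unique instead, vertex and colour can be deleted together.  Every strong
-- colouring can be moved into either form, so (n,k) follows from (n-1,k) when k = 4 and
-- from (n-1,k-1) when k ≥ 5; what remains is (6,4) and (6,5), settled by graph search.
--
-- For disconnectedness: with k = 2 no vertex can change colour; with k = 3 and n ≥ 5 a
-- recolouring preserves the winding number of the cycle around the triangle of colours,
-- counted here as the number of ascents 0 → 1 → 2 → 0; (4,3) and (5,4) are finite.
module Submission where

open import Defs
open import Data.Bool using (Bool; true; false; if_then_else_; T)
open import Data.Bool.Properties using (T?)
open import Data.Fin as Fin using (Fin; zero; suc; toℕ; fromℕ; inject₁; punchIn; punchOut)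
open import Data.Fin.Patterns
open import Data.Fin.Permutation.Components using (transpose; transpose-inverse)
open import Data.Fin.Properties using (_≟_; all?; any?; toℕ-fromℕ; toℕ-inject₁; toℕ-injective; toℕ<n;
  pigeonhole; ¬∀⟶∃¬; <⇒≢; punchIn-injective; punchInᵢ≢i; punchIn-punchOut; punchOut-injective; injective⇒≤)
open import Data.Fin.Relation.Unary.Top using (view; ‵fromℕ; ‵inject₁)
open import Data.List using (List; []; _∷_; _++_; allFin; filter; cartesianProductWith; length)
open import Data.List.Membership.Propositional.Properties using (∈-allFin)
open import Data.List.Relation.Unary.All as All using (All; []; _∷_)
open import Data.List.Relation.Unary.All.Properties using (all-filter; filter⁺; cartesianProductWith⁺; ++⁺)
open import Data.Nat using (ℕ; zero; suc; _+_; _≤_; _<_; s≤s; z≤n)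
import Data.Nat.Properties as ℕ
open import Data.Nat.Tactic.RingSolver using (solve-∀)
open import Data.Product using (Σ; ∃; ∃₂; _×_; _,_; proj₁; proj₂)
open import Data.Sum using (_⊎_; inj₁; inj₂; swap; [_,_]′)
open import Data.Vec using (Vec; []; _∷_; lookup; tabulate; replicate; _[_]≔_; head)
open import Data.Vec.Functional using (updateAt) renaming (_∷_ to _◂_)
open import Data.Vec.Functional.Properties using (updateAt-updates; updateAt-minimal)
open import Data.Vec.Properties using (lookup∘tabulate; lookup∘update; lookup∘update′; lookup-replicate;
  tabulate∘lookup; tabulate-cong)
open import Function using (_∘_; const)
open import Function.Bundles using (_⇔_; mk⇔)
open import Relation.Binary.PropositionalEquality
open import Relation.Nullary using (¬_; Dec; yes; no; contradiction)
open import Relation.Nullary.Decidable using (_×-dec_; _⊎-dec_; _→-dec_; ¬?; map′; toWitness; decidable-stable; dec-false)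
open import Relation.Unary using (Decidable)

-- Walks and single recolourings

module _ {n k : ℕ} {G : Graph n} where

  SAdj-sym : {c d : StrongCol G k} → SAdj c d → SAdj d c
  SAdj-sym (v , ne , eq) = v , ne ∘ sym , λ u u≢v → sym (eq u u≢v)

  SAdj-resp : {c c' d : StrongCol G k} → col c ≗ col c' → SAdj c' d → SAdj c d
  SAdj-resp e (v , ne , eq) = v , ne ∘ trans (sym (e v)) , λ u u≢v → trans (e u) (eq u u≢v)

  reach-resp : {c c' d : StrongCol G k} → col c ≗ col c' → Reachable c' d → Reachable c d
  reach-resp e (here f)                     = here λ v → trans (e v) (f v)
  reach-resp {c} {c'} e (step {c' = x} a r) = step (SAdj-resp {c} {c'} {x} e a) r

  reach-trans : {c d e : StrongCol G k} → Reachable c d → Reachable d e → Reachable c e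
  reach-trans (here f)   s = reach-resp f s
  reach-trans (step a r) s = step a (reach-trans r s)

  reach-refl : {c : StrongCol G k} → Reachable c c
  reach-refl = here λ _ → refl

  reach-sym : {c d : StrongCol G k} → Reachable c d → Reachable d c
  reach-sym (here f) = here (sym ∘ f)
  reach-sym (step {c} {c'} a r) =
    reach-trans (reach-sym r) (step (SAdj-sym {c} {c'} a) reach-refl)

  -- A move must change a colour, so the two colourings are compared at `v`: if they agree there as
  -- well, the walk is empty.
  reach-differ : {c d : StrongCol G k} (v : Fin n) →
    (∀ u → u ≢ v → col c u ≡ col d u) → Reachable c d
  reach-differ {c} {d} v eq with col c v ≟ col d v
  ... | no ne = step (v , ne , eq) reach-refl
  ... | yes e = here λ u → case-≟ u (u ≟ v)
    where
    case-≟ : ∀ u → Dec (u ≡ v) → col c u ≡ col d u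
    case-≟ u (yes refl) = e
    case-≟ u (no u≢v)   = eq u u≢v

  Repeated : StrongCol G k → Fin n → Set
  Repeated c v = ∃ λ j → j ≢ v × col c j ≡ col c v

  -- The old colour of `v` is still witnessed at the repeat `j`, so the new colouring stays strong.
  recolour : (∀ {u w} → G u w → G w u) → (c : StrongCol G k) (v : Fin n) (a : Fin k) →
    (∀ u → G u v → col c u ≢ a) → Repeated c v →
    ∃ λ c' → Reachable c c' × col c' v ≡ a × (∀ u → u ≢ v → col c' u ≡ col c u)
  recolour G-sym c v a free (j , j≢v , cj≡cv) =
    c' , reach-differ v (λ u → sym ∘ other u) , new , other
    where
    f : Fin n → Fin k
    f = updateAt (col c) v (const a)
    new : f v ≡ a
    new = updateAt-updates v (col c)
    other : ∀ u → u ≢ v → f u ≡ col c u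
    other u = updateAt-minimal u v (col c)
    f-proper : Proper G k f
    f-proper u w g with u ≟ v | w ≟ v
    ... | yes refl | yes refl = λ _ → proper c v v g refl
    ... | yes refl | no w≢v   = λ e → free w (G-sym g) (trans (sym (other w w≢v)) (trans (sym e) new))
    ... | no u≢v   | yes refl = λ e → free u g (trans (sym (other u u≢v)) (trans e new))
    ... | no u≢v   | no w≢v   = λ e → proper c u w g (trans (sym (other u u≢v)) (trans e (other w w≢v)))
    f-strong : Strong k f
    f-strong b with strong c b
    ... | i , ci≡b with i ≟ v
    ... | yes refl = j , trans (other j j≢v) (trans cj≡cv ci≡b)
    ... | no i≢v   = i , trans (other i i≢v) ci≡b
    c' : StrongCol G k
    c' = mkSC f f-proper f-strong

-- Cycles and free colours

-- Were every colour hit, choosing a preimage of each would inject the `k` colours into `m` indices.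
missed : ∀ {m k} → m < k → (f : Fin m → Fin k) → ∃ λ z → ∀ i → f i ≢ z
missed {m} {k} m<k f with any? (λ z → all? λ i → ¬? (f i ≟ z))
... | yes p = p
... | no ¬p = contradiction (injective⇒≤ {f = proj₁ ∘ hit} inj) (ℕ.<⇒≱ m<k)
  where
  hit : ∀ z → ∃ λ i → f i ≡ z
  hit z with i , ne ← ¬∀⟶∃¬ m (λ i → f i ≢ z) (λ i → ¬? (f i ≟ z)) (λ q → ¬p (z , q))
    = i , decidable-stable (f i ≟ z) ne
  inj : ∀ {x y} → proj₁ (hit x) ≡ proj₁ (hit y) → x ≡ y
  inj {x} {y} e = trans (sym (proj₂ (hit x))) (trans (cong f e) (proj₂ (hit y)))

-- The induction steps use the bound of four colours through this alone: the colours of two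
-- neighbours and one further colour can be avoided at once.
fresh : ∀ {k} → 4 ≤ k → (a b c : Fin k) → ∃ λ z → a ≢ z × b ≢ z × c ≢ z
fresh 4≤k a b c with z , ne ← missed 4≤k (lookup (a ∷ b ∷ c ∷ []))
  = z , ne zero , ne (suc zero) , ne (suc (suc zero))

prev : ∀ {m} → Fin (suc m) → Fin (suc m)
prev zero    = fromℕ _
prev (suc i) = inject₁ i

prev-CycSucc : ∀ {m} (v : Fin (suc m)) → CycSucc (suc m) (prev v) v
prev-CycSucc zero    = inj₂ (cong suc (toℕ-fromℕ _) , refl)
prev-CycSucc (suc i) = inj₁ (cong suc (toℕ-inject₁ i))

CycSucc-prev : ∀ {m} {u v : Fin (suc m)} → CycSucc (suc m) u v → u ≡ prev v
CycSucc-prev {v = suc j} (inj₁ e) = toℕ-injective (trans (ℕ.suc-injective e) (sym (toℕ-inject₁ j)))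
CycSucc-prev {v = zero} (inj₂ (e , _)) = toℕ-injective (trans (ℕ.suc-injective e) (sym (toℕ-fromℕ _)))

CycSucc-functional : ∀ {n} {u v w : Fin n} → CycSucc n u v → CycSucc n u w → v ≡ w
CycSucc-functional (inj₁ p)       (inj₁ q)       = toℕ-injective (trans (sym p) q)
CycSucc-functional (inj₂ (_ , p)) (inj₂ (_ , q)) = toℕ-injective (trans p (sym q))
CycSucc-functional {v = v} (inj₁ p) (inj₂ (q , _)) =
  contradiction (trans (sym p) q) (ℕ.<⇒≢ (toℕ<n v))
CycSucc-functional {w = w} (inj₂ (q , _)) (inj₁ p) =
  contradiction (trans (sym p) q) (ℕ.<⇒≢ (toℕ<n w))

next : ∀ {m} (v : Fin (suc m)) → ∃ λ w → CycSucc (suc m) v w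
next v with view v
... | ‵fromℕ     = zero , prev-CycSucc zero
... | ‵inject₁ i = suc i , prev-CycSucc (suc i)

Cycle-sym : ∀ {n} {u v : Fin n} → Cycle n u v → Cycle n v u
Cycle-sym = swap

Cycle-neighbours : ∀ {m} (v : Fin (suc m)) → ∃₂ λ p q → ∀ u → Cycle (suc m) u v → u ≡ p ⊎ u ≡ q
Cycle-neighbours v with w , s ← next v = prev v , w , λ where
  u (inj₁ r) → inj₁ (CycSucc-prev r)
  u (inj₂ r) → inj₂ (CycSucc-functional r s)

fresh-at : ∀ {m k} → 4 ≤ k → (c : Fin (suc m) → Fin k) (v : Fin (suc m)) (b : Fin k) →
  ∃ λ z → (∀ u → Cycle (suc m) u v → c u ≢ z) × b ≢ z
fresh-at 4≤k c v b with p , q , nb ← Cycle-neighbours v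
  with z , cp≢z , cq≢z , b≢z ← fresh 4≤k (c p) (c q) b
  = z , (λ u g → [ (λ { refl → cp≢z }) , (λ { refl → cq≢z }) ]′ (nb u g)) , b≢z

-- Each edge is checked once, from its successor end, which turns properness into one condition per
-- vertex.
PrevProper : ∀ {m k} → (Fin (suc m) → Fin k) → Set
PrevProper c = ∀ v → c (prev v) ≢ c v

PrevProper⇒Proper : ∀ {m k} {c : Fin (suc m) → Fin k} → PrevProper c → Proper (Cycle (suc m)) k c
PrevProper⇒Proper p u v (inj₁ s) e with refl ← CycSucc-prev s = p v e
PrevProper⇒Proper p u v (inj₂ s) e with refl ← CycSucc-prev s = p u (sym e)

Proper⇒PrevProper : ∀ {m k} {c : Fin (suc m) → Fin k} → Proper (Cycle (suc m)) k c → PrevProper c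
Proper⇒PrevProper p v = p (prev v) v (inj₁ (prev-CycSucc v))

proper-◂ : ∀ {m k a} {c : Fin (suc m) → Fin k} → Proper (Cycle (suc m)) k c →
  c zero ≢ a → c (fromℕ m) ≢ a → Proper (Cycle (suc (suc m))) k (a ◂ c)
proper-◂ p c₀≢a cₘ≢a = PrevProper⇒Proper λ where
  zero          → cₘ≢a
  (suc zero)    → c₀≢a ∘ sym
  (suc (suc i)) → Proper⇒PrevProper p (suc i)

-- The condition under which deleting vertex 0 leaves a proper colouring.
Open : ∀ {m k} → (Fin (suc (suc m)) → Fin k) → Set
Open c = c (prev zero) ≢ c (suc zero)

proper-tail : ∀ {m k} {c : Fin (suc (suc m)) → Fin k} → Proper (Cycle (suc (suc m))) k c →
  Open c → Proper (Cycle (suc m)) k (c ∘ suc)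
proper-tail p c₁≢cₗ = PrevProper⇒Proper λ where
  zero    → c₁≢cₗ
  (suc i) → Proper⇒PrevProper p (suc (suc i))

repeated? : ∀ {n k} {G : Graph n} (c : StrongCol G k) v → Dec (Repeated c v)
repeated? c v = any? λ j → ¬? (j ≟ v) ×-dec (col c j ≟ col c v)

Colouring : ℕ → ℕ → Set
Colouring n k = StrongCol (Cycle n) k

infix 4 _↝_
_↝_ : ∀ {n k} → Colouring n k → Colouring n k → Set
c ↝ d = Reachable c d

-- Openness and the colour of 0 depend on these three vertices only, so they survive moves made
-- elsewhere.
record _≗₀_ {m k} (c d : Fin (suc (suc m)) → Fin k) : Set where
  constructor agree
  field
    at-0    : c zero ≡ d zero
    at-next : c (suc zero) ≡ d (suc zero)
    at-prev : c (prev zero) ≡ d (prev zero)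
open _≗₀_

≗₀-refl : ∀ {m k} {c : Fin (suc (suc m)) → Fin k} → c ≗₀ c
≗₀-refl = agree refl refl refl

≗₀-trans : ∀ {m k} {c d e : Fin (suc (suc m)) → Fin k} → c ≗₀ d → d ≗₀ e → c ≗₀ e
≗₀-trans (agree a b c) (agree a' b' c') = agree (trans a a') (trans b b') (trans c c')

Open-resp : ∀ {m k} {c d : Fin (suc (suc m)) → Fin k} → c ≗₀ d → Open d → Open c
Open-resp (agree _ n p) o e = o (trans (sym p) (trans e n))

adjacent-to-0 : ∀ {m} {u : Fin (suc (suc m))} → Cycle (suc (suc m)) u zero → u ≡ suc zero ⊎ u ≡ prev zero
adjacent-to-0 (inj₁ s) = inj₂ (CycSucc-prev s)
adjacent-to-0 (inj₂ s) = inj₁ (CycSucc-functional s (inj₁ refl))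

-- Deleting vertex 0

module _ {m k : ℕ} where

  -- If the neighbours of 0 share a colour, each is a repeat of the other, so vertex 1 may move.
  -- They are distinct because the cycle has length at least 3.
  open-up : 4 ≤ k → (c : Colouring (3 + m) k) → ∃ λ c' → c ↝ c' × Open (col c')
  open-up 4≤k c with col c (prev zero) ≟ col c (suc zero)
  ... | no ne = c , reach-refl , ne
  ... | yes e with z , free , cₗ≢z ← fresh-at 4≤k (col c) (suc zero) (col c (prev zero))
    with c' , r , c'₁≡z , same ← recolour Cycle-sym c (suc zero) z free (prev zero , (λ ()) , e)
    = c' , r , λ e' → cₗ≢z (trans (sym (same (prev zero) λ ())) (trans e' c'₁≡z))

  -- Of two vertices sharing a colour, at least one is not adjacent to 0, since
  -- the neighbours of 0 are coloured differently.
  duplicate₀ : k < suc (suc m) → (c : Colouring (suc (suc m)) k) → Open (col c) →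
    ∃ λ c' → c ↝ c' × col c' ≗₀ col c × Repeated c' zero
  duplicate₀ k<n c o with repeated? c zero
  ... | yes rep = c , reach-refl , ≗₀-refl , rep
  ... | no unique = copy (choose (pigeonhole k<n (col c)))
    where
    Far : Fin (suc (suc m)) → Set
    Far i = i ≢ zero × i ≢ suc zero × i ≢ prev zero × Repeated c i

    choose : (∃₂ λ i j → i Fin.< j × col c i ≡ col c j) → ∃ Far
    choose (i , j , i<j , e) with i ≟ zero | j ≟ zero
    ... | yes refl | _ = contradiction (j , <⇒≢ i<j ∘ sym , sym e) unique
    ... | no _     | yes refl = contradiction (i , <⇒≢ i<j , e) unique
    ... | no i≢0   | no j≢0 with i ≟ suc zero | i ≟ prev zero
    ... | no i≢1   | no i≢l = i , i≢0 , i≢1 , i≢l , j , <⇒≢ i<j ∘ sym , sym e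
    ... | yes refl | _ = j , j≢0 , <⇒≢ i<j ∘ sym , (λ { refl → o (sym e) }) , i , <⇒≢ i<j , e
    ... | no _     | yes refl = j , j≢0 , (λ { refl → o e }) , <⇒≢ i<j ∘ sym , i , <⇒≢ i<j , e

    -- The colour of 0 occurs nowhere else and `i` is not adjacent to 0, so no neighbour of `i`
    -- carries it.
    free : ∀ i → i ≢ suc zero → i ≢ prev zero →
      ∀ u → Cycle (suc (suc m)) u i → col c u ≢ col c zero
    free i i≢1 i≢l u g e with u ≟ zero
    ... | yes refl = [ i≢1 , i≢l ]′ (adjacent-to-0 (Cycle-sym g))
    ... | no u≢0   = unique (u , u≢0 , e)

    copy : ∃ Far → ∃ λ c' → c ↝ c' × col c' ≗₀ col c × Repeated c' zero
    copy (i , i≢0 , i≢1 , i≢l , rep)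
      with c' , r , new , same ← recolour Cycle-sym c i (col c zero) (free i i≢1 i≢l) rep
      = c' , r , agree (same zero (i≢0 ∘ sym)) (same _ (i≢1 ∘ sym)) (same _ (i≢l ∘ sym))
      , i , i≢0 , trans new (sym (same zero (i≢0 ∘ sym)))

module _ {m k : ℕ} where

  -- A colour witnessed at 0 passes its witness to the repeat in the tail; openness makes the new
  -- closing edge proper.
  forget : (e : Colouring (suc (suc m)) k) → Open (col e) → Repeated e zero → Colouring (suc m) k
  forget e o (j , j≢0 , ej≡e₀) = mkSC (col e ∘ suc) (proper-tail (proper e) o) λ a → onto a (strong e a)
    where
    tail-index : ∀ i → i ≢ zero → ∃ λ i' → suc i' ≡ i
    tail-index zero    i≢0 = contradiction refl i≢0
    tail-index (suc i) _   = i , refl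
    onto : ∀ a → (∃ λ v → col e v ≡ a) → ∃ λ v → col e (suc v) ≡ a
    onto a (suc v , p) = v , p
    onto a (zero , p) with i , refl ← tail-index j j≢0 = i , trans ej≡e₀ p

  prepend : (c : Colouring (suc m) k) (a : Fin k) → col c zero ≢ a → col c (fromℕ m) ≢ a →
    Colouring (suc (suc m)) k
  prepend c a p q = mkSC (a ◂ col c) (proper-◂ (proper c) p q)
                         λ b → suc (proj₁ (strong c b)) , proj₂ (strong c b)

  -- Before each move of the smaller cycle, vertex 0 is given a colour that avoids
  -- its neighbours both before and after the move.
  lift-forget : 4 ≤ k → {c d : Colouring (suc m) k} → c ↝ d → (e f : Colouring (suc (suc m)) k) →
    col e ∘ suc ≗ col c → col f ∘ suc ≗ col d → e ↝ f
  lift-forget 4≤k (here p) e f pe pf = reach-differ zero λ where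
    zero    z≢z → contradiction refl z≢z
    (suc u) _   → trans (pe u) (trans (p u) (sym (pf u)))
  lift-forget 4≤k (step {c} {c'} (v , ne , eq) r) e f pe pf
    with z , c₀≢z , cₗ≢z , c'v≢z ← fresh 4≤k (col c zero) (col c (fromℕ m)) (col c' v)
    = reach-trans (reach-differ {d = e₁} zero λ { zero z≢z → contradiction refl z≢z ; (suc u) _ → pe u })
     (reach-trans (reach-differ {d = e₂} (suc v) λ { zero _ → refl ; (suc u) u≢v → eq u (u≢v ∘ cong suc) })
                  (lift-forget 4≤k r e₂ f (λ _ → refl) pf))
    where
    avoid : ∀ u → col c u ≢ z → col c' u ≢ z
    avoid u cu≢z with u ≟ v
    ... | yes refl = c'v≢z
    ... | no u≢v   = cu≢z ∘ trans (eq u u≢v)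
    e₁ e₂ : Colouring (suc (suc m)) k
    e₁ = prepend c z c₀≢z cₗ≢z
    e₂ = prepend c' z (avoid zero c₀≢z) (avoid (fromℕ m) cₗ≢z)

connected-extend-vertex : ∀ {m k} → 4 ≤ k → k < 3 + m →
  SConnected (Cycle (2 + m)) k → SConnected (Cycle (3 + m)) k
connected-extend-vertex {m} {k} 4≤k k<n conn c d =
  let c₁ , rc , oc , pc = normal c
      d₁ , rd , od , pd = normal d
  in reach-trans rc (reach-trans
       (lift-forget 4≤k (conn (forget c₁ oc pc) (forget d₁ od pd)) c₁ d₁ (λ _ → refl) (λ _ → refl))
       (reach-sym rd))
  where
  normal : (c : Colouring (3 + m) k) → ∃ λ c' → c ↝ c' × (Open (col c') × Repeated c' zero)
  normal c with c₁ , r₁ , o₁ ← open-up 4≤k c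
    -- Duplicating leaves 0 and its neighbours as they are, so the openness just gained is kept.
    with c₂ , r₂ , same , rep ← duplicate₀ k<n c₁ o₁
    = c₂ , reach-trans r₁ r₂ , Open-resp same o₁ , rep

-- Deleting vertex 0 together with its colour

transpose-second : ∀ {k} (i j : Fin k) → transpose i j j ≡ i
transpose-second i j with j ≟ i
... | yes j≡i = j≡i
... | no _ with j ≟ j
...   | yes _  = refl
...   | no j≢j = contradiction refl j≢j

transpose-fixes : ∀ {k} {i j a : Fin k} → i ≢ a → j ≢ a → transpose i j a ≡ a
transpose-fixes {i = i} {j} {a} i≢a j≢a
  rewrite dec-false (a ≟ i) (i≢a ∘ sym) | dec-false (a ≟ j) (j≢a ∘ sym) = refl

transpose-injective : ∀ {k} (i j : Fin k) {a b : Fin k} → transpose i j a ≡ transpose i j b → a ≡ b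
transpose-injective i j e =
  trans (sym (transpose-inverse j i)) (trans (cong (transpose j i) e) (transpose-inverse j i))

-- Permuting colours is not itself a walk; `same-colour` later joins a normal colouring to its
-- exchange when the colour of 0 is fixed.
exchange : ∀ {n k} {G : Graph n} → Fin k → Fin k → StrongCol G k → StrongCol G k
exchange i j c = mkSC (transpose i j ∘ col c)
  (λ u v g → proper c u v g ∘ transpose-injective i j)
  (λ a → let v , p = strong c (transpose j i a)
         in v , trans (cong (transpose i j) p) (transpose-inverse i j))

module _ {m k : ℕ} where

  -- Vertices are moved off the colour of 0 one by one. Each of them has 0 as its repeat and, by
  -- properness, is not adjacent to 0; its new colour differs from that of 0, so vertices already
  -- treated stay done.
  clear₀ : 4 ≤ k → (c : Colouring (suc (suc m)) k) →
    ∃ λ c' → c ↝ c' × col c' ≗₀ col c × ¬ Repeated c' zero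
  clear₀ 4≤k c =
    let c' , r , same , clr = sweep (allFin _)
    in c' , r , same , λ (j , j≢0 , e) → All.lookup clr (∈-allFin j) j≢0 e
    where
    Done : Colouring (suc (suc m)) k → Fin (suc (suc m)) → Set
    Done c' v = v ≢ zero → col c' v ≢ col c' zero

    sweep : ∀ vs → ∃ λ c' → c ↝ c' × col c' ≗₀ col c × All (Done c') vs
    sweep [] = c , reach-refl , ≗₀-refl , []
    sweep (v ∷ vs) with c' , r , same , clr ← sweep vs
      with v ≟ zero | col c' v ≟ col c' zero
    ... | yes refl | _    = c' , r , same , (λ 0≢0 → contradiction refl 0≢0) ∷ clr
    ... | no _     | no p = c' , r , same , (λ _ → p) ∷ clr
    ... | no v≢0   | yes p
      with z , free , c₀≢z ← fresh-at 4≤k (col c') v (col c' zero)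
      with c'' , r' , new , other ← recolour Cycle-sym c' v z free (zero , v≢0 ∘ sym , sym p)
      = c'' , reach-trans r r'
      , ≗₀-trans (agree at₀ (other _ (apart (inj₁ (inj₁ refl))))
                            (other _ (apart (inj₂ (prev-CycSucc zero))))) same
      , done-v ∷ All.map (λ {u} → keep u) clr
      where
      at₀ : col c'' zero ≡ col c' zero
      at₀ = other zero (v≢0 ∘ sym)
      apart : ∀ {u} → Cycle (suc (suc m)) zero u → u ≢ v
      apart g refl = proper c' zero v g (sym p)
      done-v : Done c'' v
      done-v _ e = c₀≢z (trans (sym at₀) (trans (sym e) new))
      keep : ∀ u → Done c' u → Done c'' u
      keep u h u≢0 e with u ≟ v
      ... | yes refl = done-v u≢0 e
      ... | no u≢v   = h u≢0 (trans (sym (other u u≢v)) (trans e at₀))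

  -- As the colour of 0 occurs nowhere else, `punchOut` can delete it from the palette, and every
  -- other colour has its witness in the tail.
  forget-colour : (e : Colouring (suc (suc m)) (suc k)) → Open (col e) → ¬ Repeated e zero →
    ∃ λ (c : Colouring (suc m) k) → ∀ i → col e (suc i) ≡ punchIn (col e zero) (col c i)
  forget-colour e o unique = mkSC f f-proper f-strong , λ i → sym (punchIn-punchOut (differs i))
    where
    differs : ∀ i → col e zero ≢ col e (suc i)
    differs i p = unique (suc i , (λ ()) , sym p)
    f : Fin (suc m) → Fin k
    f i = punchOut (differs i)
    f-proper : Proper (Cycle (suc m)) k f
    f-proper u v g p = proper-tail (proper e) o u v g (punchOut-injective (differs u) (differs v) p)
    f-strong : Strong k f
    f-strong a with strong e (punchIn (col e zero) a)
    ... | zero  , p = contradiction (sym p) (punchInᵢ≢i (col e zero) a)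
    ... | suc i , p = i , punchIn-injective (col e zero) _ _ (trans (punchIn-punchOut (differs i)) p)

  prepend-colour : Fin (suc k) → Colouring (suc m) k → Colouring (suc (suc m)) (suc k)
  prepend-colour x c = mkSC (x ◂ (punchIn x ∘ col c))
    (proper-◂ (λ u v g → proper c u v g ∘ punchIn-injective x _ _) (punchInᵢ≢i x _) (punchInᵢ≢i x _))
    onto
    where
    onto : Strong (suc k) (x ◂ (punchIn x ∘ col c))
    onto a with x ≟ a
    ... | yes x≡a = zero , x≡a
    ... | no x≢a with v , p ← strong c (punchOut x≢a)
      = suc v , trans (cong (punchIn x) p) (punchIn-punchOut x≢a)

  -- Vertex 0 keeps `x`, which `punchIn x` never produces, so each move lifts unchanged. Both ends
  -- must therefore have the same colour at 0.
  lift-forget-colour : ∀ x {c d : Colouring (suc m) k} → c ↝ d → (e f : Colouring (suc (suc m)) (suc k)) →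
    col e zero ≡ x → col f zero ≡ x →
    col e ∘ suc ≗ punchIn x ∘ col c → col f ∘ suc ≗ punchIn x ∘ col d → e ↝ f
  lift-forget-colour x (here p) e f e₀ f₀ pe pf = here λ where
    zero    → trans e₀ (sym f₀)
    (suc u) → trans (pe u) (trans (cong (punchIn x) (p u)) (sym (pf u)))
  lift-forget-colour x (step {c' = c'} (v , ne , eq) r) e f e₀ f₀ pe pf =
    reach-trans (reach-differ {d = prepend-colour x c'} (suc v) λ where
                   zero    _   → e₀
                   (suc u) u≢v → trans (pe u) (cong (punchIn x) (eq u (u≢v ∘ cong suc))))
                (lift-forget-colour x r (prepend-colour x c') f refl f₀ (λ _ → refl) pf)

-- A lifted walk never changes the colour of 0, so one end is first brought to the colour that the
-- other has there.
connected-extend-both : ∀ {m k} → 4 ≤ suc k → suc k < 3 + m →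
  SConnected (Cycle (2 + m)) k → SConnected (Cycle (3 + m)) (suc k)
connected-extend-both {m} {k} 4≤k k<n conn c d =
  let c₁ , rc , nc      = normal c
      d₁ , rd , nd      = normal d
      c₂ , r  , n₂ , e₂ = set-colour c₁ nc (col d₁ zero)
  in reach-trans rc (reach-trans r (reach-trans (same-colour c₂ d₁ n₂ nd e₂) (reach-sym rd)))
  where
  K = Colouring (3 + m) (suc k)

  Normal : K → Set
  Normal c = Open (col c) × ¬ Repeated c zero

  clear : (c : K) → Open (col c) → ∃ λ c' → c ↝ c' × Normal c' × col c' zero ≡ col c zero
  clear c o with c' , r , same , u ← clear₀ 4≤k c
    = c' , r , (Open-resp same o , u) , at-0 same

  normal : (c : K) → ∃ λ c' → c ↝ c' × Normal c'
  normal c with c₁ , r₁ , o₁ ← open-up 4≤k c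
    with c₂ , r₂ , n₂ , _ ← clear c₁ o₁
    = c₂ , reach-trans r₁ r₂ , n₂

  same-colour : (c d : K) → Normal c → Normal d → col c zero ≡ col d zero → c ↝ d
  same-colour c d (oc , uc) (od , ud) e
    with c' , pc ← forget-colour c oc uc | d' , pd ← forget-colour d od ud
    = lift-forget-colour (col d zero) (conn c' d') c d e refl
        (subst (λ x → col c ∘ suc ≗ punchIn x ∘ col c') e pc) pd

  -- First permute colours so that x is absent from the neighbours of 0, then
  -- duplicate the colour of 0 elsewhere, so that 0 may take the colour x.
  set-colour : (c : K) → Normal c → (x : Fin (suc k)) → ∃ λ c' → c ↝ c' × Normal c' × col c' zero ≡ x
  set-colour c (o , u) x with x ≟ col c zero
  ... | yes e = c , reach-refl , (o , u) , sym e
  ... | no x≢c₀ with z , c₀≢z , c₁≢z , cₗ≢z ← fresh 4≤k (col c zero) (col c (suc zero)) (col c (prev zero))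
    = let t = exchange x z c
          -- Neither exchanged colour is that of 0, so `c` and `t` agree at 0 and `same-colour`
          -- joins them.
          t₀ = transpose-fixes x≢c₀ (c₀≢z ∘ sym)
          ot : Open (col t)
          ot = o ∘ transpose-injective x z
          ut : ¬ Repeated t zero
          ut = λ (j , j≢0 , e) → u (j , j≢0 , transpose-injective x z e)
          c₂ , r₂ , same , rep = duplicate₀ k<n t ot
          nx : ∀ {v} → col c v ≢ z → col t v ≢ x
          nx = λ cv≢z e → cv≢z (transpose-injective x z (trans e (sym (transpose-second x z))))
          free : ∀ v → Cycle (3 + m) v zero → col c₂ v ≢ x
          free = λ v g → [ (λ { refl → nx c₁≢z ∘ trans (sym (at-next same)) })
                         , (λ { refl → nx cₗ≢z ∘ trans (sym (at-prev same)) }) ]′ (adjacent-to-0 g)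
          c₃ , r₃ , new , other = recolour Cycle-sym c₂ zero x free rep
          o₃ : Open (col c₃)
          o₃ = λ e → Open-resp same ot (trans (sym (other _ λ ())) (trans e (other _ λ ())))
          -- The colour `x` may also occur away from 0, so uniqueness has to be restored.
          c₄ , r₄ , n₄ , c₄₀ = clear c₃ o₃
      in c₄ , reach-trans (same-colour c t (o , u) (ot , ut) (sym t₀)) (reach-trans r₂ (reach-trans r₃ r₄))
         , n₄ , trans c₄₀ new

-- Invariants of walks

-- The hypothesis also speaks of colourings that agree at `v`; that case handles `here`, where
-- equality is only pointwise.
reach-invariant : ∀ {m k} {G : Graph (suc m)} {A : Set} (I : StrongCol G k → A) →
  (∀ c d v → (∀ u → u ≢ v → col c u ≡ col d u) → I c ≡ I d) →
  ∀ {c d} → Reachable c d → I c ≡ I d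
reach-invariant I inv (here e)                      = inv _ _ zero (λ u _ → e u)
reach-invariant I inv (step {c} {c'} (v , _ , eq) r) = trans (inv c c' v eq) (reach-invariant I inv r)

prev≢ : ∀ {m} (v : Fin (suc (suc m))) → prev v ≢ v
prev≢ zero    ()
prev≢ (suc i) e = ℕ.1+n≢n (sym (trans (sym (toℕ-inject₁ i)) (cong toℕ e)))

-- Two colours

others-equal : {a b x : Fin 2} → a ≢ x → b ≢ x → a ≡ b
others-equal {a} {b} {x} = toWitness {a? = all? λ a → all? λ b → all? λ x →
  ¬? (a ≟ x) →-dec ¬? (b ≟ x) →-dec (a ≟ b)} _ a b x

-- The given colouring and its colour exchange differ at 0, yet the colour of 0 is forced by that of
-- its predecessor, which a move at 0 leaves alone.
disconnected-2 : ∀ {m} → ChromaticAtMost (Cycle (suc (suc m))) 2 → ¬ SConnected (Cycle (suc (suc m))) 2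
disconnected-2 {m} (f , p) conn = moved (f zero) (reach-invariant (λ c → col c zero) rigid (conn d c))
  where
  onto : Strong 2 f
  onto a with f (prev zero) ≟ a
  ... | yes e = prev zero , e
  ... | no ne = zero , others-equal (Proper⇒PrevProper p zero ∘ sym) (ne ∘ sym)
  c d : Colouring (suc (suc m)) 2
  c = mkSC f p onto
  d = exchange 0F 1F c
  moved : (a : Fin 2) → transpose 0F 1F a ≢ a
  moved 0F ()
  moved 1F ()
  rigid : ∀ (c d : Colouring (suc (suc m)) 2) v → (∀ u → u ≢ v → col c u ≡ col d u) → col c zero ≡ col d zero
  rigid c d v eq with zero ≟ v
  ... | no 0≢v   = eq zero 0≢v
  ... | yes refl = others-equal (Proper⇒PrevProper (proper c) zero ∘ sym)
    (λ e → Proper⇒PrevProper (proper d) zero (trans (sym (eq (prev zero) (prev≢ zero))) (sym e)))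

-- Three colours: ascents around the cycle

ascent : Fin 3 → Fin 3 → ℕ
ascent 0F 1F = 1
ascent 1F 2F = 1
ascent 2F 0F = 1
ascent _  _  = 0

-- The potential by which ascent changes along an edge when one end is recoloured from
-- a to b, offset by 1 to stay in ℕ; it telescopes along the cycle.
shift : Fin 3 → Fin 3 → ℕ
shift a b with a ≟ b
... | yes _ = 1
... | no _  = ascent b a + ascent b a

-- At most one end moves. If it changes colour, its two colours and that of the other end are all
-- three, and the cyclic order determines both sides.
ascent-shift : ∀ a a' b b' → a ≢ b → a' ≢ b' → a ≡ a' ⊎ b ≡ b' →
  ascent a' b' + shift a a' ≡ ascent a b + shift b b'
ascent-shift = toWitness {a? = all? λ a → all? λ a' → all? λ b → all? λ b' →
  ¬? (a ≟ b) →-dec ¬? (a' ≟ b') →-dec (a ≟ a' ⊎-dec b ≟ b') →-dec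
  (ascent a' b' + shift a a' ℕ.≟ ascent a b + shift b b')} _

ascent-antisym : ∀ a b → a ≢ b → ascent a b + ascent b a ≡ 1
ascent-antisym = toWitness {a? = all? λ a → all? λ b →
  ¬? (a ≟ b) →-dec (ascent a b + ascent b a ℕ.≟ 1)} _

path-ascents : ∀ {m} → (Fin (suc m) → Fin 3) → ℕ
path-ascents {zero}  c = 0
path-ascents {suc m} c = ascent (c zero) (c (suc zero)) + path-ascents (c ∘ suc)

ascents : ∀ {m} → (Fin (suc m) → Fin 3) → ℕ
ascents c = ascent (c (prev zero)) (c zero) + path-ascents c

-- Summed over the edges, the shift at each inner vertex stands on both sides and cancels.
path-telescope : ∀ {m} (c d : Fin (suc m) → Fin 3) →
  (∀ i → ascent (d (inject₁ i)) (d (suc i)) + shift (c (inject₁ i)) (d (inject₁ i))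
       ≡ ascent (c (inject₁ i)) (c (suc i)) + shift (c (suc i)) (d (suc i))) →
  path-ascents d + shift (c zero) (d zero) ≡ path-ascents c + shift (c (fromℕ m)) (d (fromℕ m))
path-telescope {zero}  c d h = refl
path-telescope {suc m} c d h = begin
  (ascent (d zero) (d 1F) + D) + shift (c zero) (d zero)  ≡⟨ swap-last (ascent (d zero) (d 1F)) D _ ⟩
  (ascent (d zero) (d 1F) + shift (c zero) (d zero)) + D  ≡⟨ cong (_+ D) (h zero) ⟩
  (ascent (c zero) (c 1F) + shift (c 1F) (d 1F)) + D      ≡⟨ swap-last (ascent (c zero) (c 1F)) _ D ⟩
  (ascent (c zero) (c 1F) + D) + shift (c 1F) (d 1F)      ≡⟨ ℕ.+-assoc (ascent (c zero) (c 1F)) D _ ⟩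
  ascent (c zero) (c 1F) + (D + shift (c 1F) (d 1F))      ≡⟨ cong (ascent (c zero) (c 1F) +_) (path-telescope (c ∘ suc) (d ∘ suc) (h ∘ suc)) ⟩
  ascent (c zero) (c 1F) + (C + _)                        ≡⟨ ℕ.+-assoc (ascent (c zero) (c 1F)) C _ ⟨
  (ascent (c zero) (c 1F) + C) + _                        ∎
  where
  open ≡-Reasoning
  C = path-ascents (c ∘ suc)
  D = path-ascents (d ∘ suc)
  swap-last : ∀ x y z → (x + y) + z ≡ (x + z) + y
  swap-last x y z = trans (ℕ.+-assoc x y z) (trans (cong (x +_) (ℕ.+-comm y z)) (sym (ℕ.+-assoc x z y)))

-- The closing edge contributes the two end shifts left by `path-telescope` with sides exchanged, so
-- around the cycle all shifts cancel.
ascents-invariant : ∀ {m} (c d : Colouring (suc (suc m)) 3) v →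
  (∀ u → u ≢ v → col c u ≡ col d u) → ascents (col c) ≡ ascents (col d)
ascents-invariant {m} c d v eq = sym (ℕ.+-cancelʳ-≡ (s zero + s (prev zero)) _ _ (begin
  (A (col d) + P (col d)) + (s zero + s (prev zero)) ≡⟨ regroup (A (col d)) (P (col d)) _ _ ⟩
  (P (col d) + s zero) + (A (col d) + s (prev zero)) ≡⟨ cong₂ _+_ (path-telescope (col c) (col d) (edge ∘ suc)) (edge zero) ⟩
  (P (col c) + s (prev zero)) + (A (col c) + s zero) ≡⟨ ℕ.+-comm (P (col c) + s (prev zero)) _ ⟩
  (A (col c) + s zero) + (P (col c) + s (prev zero)) ≡⟨ regroup′ (A (col c)) (s zero) (P (col c)) _ ⟩
  (A (col c) + P (col c)) + (s zero + s (prev zero)) ∎))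
  where
  open ≡-Reasoning
  s : Fin (suc (suc m)) → ℕ
  s u = shift (col c u) (col d u)
  A P : (Fin (suc (suc m)) → Fin 3) → ℕ
  A c = ascent (c (prev zero)) (c zero)
  P c = path-ascents c
  regroup′ : ∀ w x y z → (w + x) + (y + z) ≡ (w + y) + (x + z)
  regroup′ = solve-∀
  regroup : ∀ w x y z → (w + x) + (y + z) ≡ (x + y) + (w + z)
  regroup = solve-∀
  edge : ∀ u → ascent (col d (prev u)) (col d u) + s (prev u) ≡ ascent (col c (prev u)) (col c u) + s u
  edge u = ascent-shift _ _ _ _ (Proper⇒PrevProper (proper c) u) (Proper⇒PrevProper (proper d) u) (one (u ≟ v))
    where
    one : Dec (u ≡ v) → col c (prev u) ≡ col d (prev u) ⊎ col c u ≡ col d u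
    one (yes refl) = inj₁ (eq (prev u) (prev≢ u))
    one (no u≢v)   = inj₂ (eq u u≢v)

-- Running back and forth once more along the closing edge adds two edges of opposite direction,
-- exactly one of them an ascent.
grow : ∀ {m} (c : Colouring (suc m) 3) →
  ∃ λ (d : Colouring (suc (suc (suc m))) 3) → ascents (col d) ≡ suc (ascents (col c))
grow {m} c = mkSC f (PrevProper⇒Proper pp) (λ a → suc (suc (proj₁ (strong c a))) , proj₂ (strong c a)) , count
  where
  x y : Fin 3
  x = col c zero
  y = col c (prev zero)
  f : Fin (suc (suc (suc m))) → Fin 3
  f = x ◂ (y ◂ col c)
  y≢x : y ≢ x
  y≢x = Proper⇒PrevProper (proper c) zero
  pp : PrevProper f
  pp zero                = y≢x
  pp (suc zero)          = y≢x ∘ sym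
  pp (suc (suc zero))    = y≢x
  pp (suc (suc (suc i))) = Proper⇒PrevProper (proper c) (suc i)
  count : ascents f ≡ suc (ascents (col c))
  count = begin
    ascent y x + (ascent x y + (ascent y x + path-ascents (col c))) ≡⟨ regroup (ascent y x) (ascent x y) _ ⟩
    (ascent x y + ascent y x) + (ascent y x + path-ascents (col c)) ≡⟨ cong (_+ ascents (col c)) (ascent-antisym x y (y≢x ∘ sym)) ⟩
    suc (ascents (col c)) ∎
    where
    open ≡-Reasoning
    regroup : ∀ p q r → p + (q + (p + r)) ≡ (q + p) + (p + r)
    regroup = solve-∀

-- Exhaustive search over small cycles

proper? : ∀ {m k} (c : Fin (suc m) → Fin k) → Dec (Proper (Cycle (suc m)) k c)
proper? c = map′ PrevProper⇒Proper Proper⇒PrevProper (all? λ v → ¬? (c (prev v) ≟ c v))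

strong? : ∀ {n k} (c : Fin n → Fin k) → Dec (Strong k c)
strong? c = all? λ a → any? λ v → c v ≟ a

Word : ℕ → ℕ → Set
Word n k = Vec (Fin k) n

Valid : ∀ {n k} → Word n k → Set
Valid {n} {k} w = Proper (Cycle n) k (lookup w) × Strong k (lookup w)

valid? : ∀ {m k} (w : Word (suc m) k) → Dec (Valid w)
valid? w = proper? (lookup w) ×-dec strong? (lookup w)

colouring : ∀ {n k} (w : Word n k) → Valid w → Colouring n k
colouring w (p , s) = mkSC (lookup w) p s

Valid-tabulate : ∀ {n k} (c : Colouring n k) → Valid (tabulate (col c))
Valid-tabulate c =
    (λ u v g e → proper c u v g (trans (sym (at u)) (trans e (at v))))
  , (λ a → let v , p = strong c a in v , trans (at v) p)
  where
  at : ∀ u → lookup (tabulate (col c)) u ≡ col c u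
  at = lookup∘tabulate (col c)

allWords? : ∀ {n k} {P : Word n k → Set} → Decidable P → Dec (∀ w → P w)
allWords? {zero}  P? = map′ (λ { p [] → p }) (λ p → p []) (P? [])
allWords? {suc n} P? = map′ (λ { p (a ∷ w) → p a w }) (λ p a w → p (a ∷ w))
                            (all? λ a → allWords? λ w → P? (a ∷ w))

-- A set of words branching on each letter, so that membership costs one lookup per vertex.
Trie : ℕ → ℕ → Set
Trie zero    k = Bool
Trie (suc n) k = Vec (Trie n k) k

empty : ∀ {n k} → Trie n k
empty {zero}  = false
empty {suc n} = replicate _ empty

member : ∀ {n k} → Word n k → Trie n k → Bool
member []      t = t
member (a ∷ w) t = member w (lookup t a)

insert : ∀ {n k} → Word n k → Trie n k → Trie n k
insert []      t = true
insert (a ∷ w) t = t [ a ]≔ insert w (lookup t a)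

member-empty : ∀ {n k} (w : Word n k) → ¬ T (member w empty)
member-empty {suc n} {k} (a ∷ w) h =
  member-empty w (subst (T ∘ member w) (lookup-replicate a (empty {n} {k})) h)

member-insert : ∀ {n k} (w x : Word n k) t → T (member w (insert x t)) → w ≡ x ⊎ T (member w t)
member-insert []      []      t _ = inj₁ refl
member-insert {suc n} {k} (a ∷ w) (b ∷ x) t h with a ≟ b
... | no a≢b = inj₂ (subst (T ∘ member w) (lookup∘update′ {A = Trie n k} a≢b t _) h)
... | yes refl with member-insert w x (lookup t a) (subst (T ∘ member w) (lookup∘update {A = Trie n k} a t _) h)
...   | inj₁ w≡x = inj₁ (cong (a ∷_) w≡x)
...   | inj₂ h'  = inj₂ h'

moves : ∀ {m k} → Word (suc m) k → List (Word (suc m) k)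
-- Rewriting a letter by itself gives `w` again, which `explore` skips as already inserted.
moves w = filter valid? (cartesianProductWith (w [_]≔_) (allFin _) (allFin _))

-- Depth-first search. Running out of fuel only leaves the trie smaller: soundness is unaffected,
-- and completeness is checked afterwards by `covers?`.
explore : ∀ {m k} → ℕ → List (Word (suc m) k) → Trie (suc m) k → Trie (suc m) k
explore zero    ws       t = t
explore (suc f) []       t = t
explore (suc f) (w ∷ ws) t =
  if member w t then explore f ws t else explore f (moves w ++ ws) (insert w t)

module _ {m k : ℕ} (r : Colouring (suc m) k) where

  Found : Word (suc m) k → Set
  Found w = Σ (Valid w) λ p → r ↝ colouring w p

  moves-found : ∀ {w} → Found w → All Found (moves w)
  moves-found {w} (p , path) =
    All.zipWith {P = Valid} {Q = Near} {R = Found} (λ {x} → extend {x}) (all-filter valid? ws , filter⁺ valid? near)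
    where
    Near : Word (suc m) k → Set
    Near x = ∃ λ v → ∀ u → u ≢ v → lookup w u ≡ lookup x u
    ws = cartesianProductWith (w [_]≔_) (allFin _) (allFin _)
    near : All Near ws
    near = cartesianProductWith⁺ (setoid _) (setoid _) (w [_]≔_) (allFin _) (allFin _)
             λ {v} {a} _ _ → v , λ u u≢v → sym (lookup∘update′ u≢v w a)
    extend : ∀ {x} → Valid x × Near x → Found x
    extend {x} (q , v , eq) = q , reach-trans path (reach-differ {c = colouring w p} {d = colouring x q} v eq)

  -- Invariant of the search: every word on the stack or in the trie is reached from `r`.
  explore-found : ∀ f ws t → All Found ws → (∀ w → T (member w t) → Found w) →
    ∀ w → T (member w (explore f ws t)) → Found w
  explore-found zero    ws       t _        old = old
  explore-found (suc f) []       t _        old = old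
  explore-found (suc f) (w ∷ ws) t (p ∷ ps) old with member w t
  ... | true  = explore-found f ws t ps old
  ... | false = explore-found f (moves w ++ ws) (insert w t) (++⁺ (moves-found p) ps) λ x h →
    case-insert x (member-insert x w t h)
    where
    case-insert : ∀ x → x ≡ w ⊎ T (member x t) → Found x
    case-insert x (inj₁ refl) = p
    case-insert x (inj₂ h)    = old x h

Covers : ∀ {n k} → Trie n k → Set
Covers t = ∀ w → Valid w → T (member w t)

-- The trie is a bound variable here so that the search runs once, not once per word.
covers? : ∀ {m k} (t : Trie (suc m) k) → Dec (Covers t)
covers? t = allWords? λ w → valid? w →-dec T? (member w t)

module _ {m k : ℕ} (fuel : ℕ) (r : Word (suc m) k) (p : Valid r) where

  connected-by-search : Covers (explore fuel (r ∷ []) empty) → SConnected (Cycle (suc m)) k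
  connected-by-search cov c d = reach-trans (reach-sym (from-root c)) (from-root d)
    where
    from-root : ∀ c → colouring r p ↝ c
    from-root c
      with _ , path ← explore-found (colouring r p) fuel (r ∷ []) empty ((p , here (λ _ → refl)) ∷ [])
                        (λ w h → contradiction h (member-empty {k = k} w))
                        (tabulate (col c)) (cov (tabulate (col c)) (Valid-tabulate c))
      = reach-trans path (here (lookup∘tabulate (col c)))

connected-6-4 : SConnected (Cycle 6) 4
connected-6-4 = connected-by-search 10000 r (toWitness {a? = valid? r} _) (toWitness {a? = covers? _} _)
  where
  r : Word 6 4
  r = 0F ∷ 1F ∷ 2F ∷ 0F ∷ 1F ∷ 3F ∷ []

connected-6-5 : SConnected (Cycle 6) 5
connected-6-5 = connected-by-search 10000 r (toWitness {a? = valid? r} _) (toWitness {a? = covers? _} _)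
  where
  r : Word 6 5
  r = 0F ∷ 1F ∷ 2F ∷ 0F ∷ 3F ∷ 4F ∷ []

-- Invariants checked over all words

Locked : ∀ {m k} → (Word (suc m) k → ℕ) → Set
Locked I = ∀ w → Valid w → ∀ v a → Valid (w [ v ]≔ a) → I w ≡ I (w [ v ]≔ a)

locked? : ∀ {m k} (I : Word (suc m) k → ℕ) → Dec (Locked I)
locked? I = allWords? λ w → valid? w →-dec all? λ v → all? λ a →
  valid? (w [ v ]≔ a) →-dec (I w ℕ.≟ I (w [ v ]≔ a))

-- Colourings that agree off `v` tabulate to words one update apart, so the finite check `Locked`
-- covers every move.
disconnected-by : ∀ {m k} (I : Word (suc m) k → ℕ) → Locked I →
  (w x : Word (suc m) k) → Valid w → Valid x → I w ≢ I x → ¬ SConnected (Cycle (suc m)) k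
disconnected-by {m} {k} I locked w x p q Iw≢Ix conn = Iw≢Ix (begin
  I w                     ≡⟨ cong I (tabulate∘lookup w) ⟨
  I (tabulate (lookup w)) ≡⟨ reach-invariant (I ∘ tabulate ∘ col) inv (conn (colouring w p) (colouring x q)) ⟩
  I (tabulate (lookup x)) ≡⟨ cong I (tabulate∘lookup x) ⟩
  I x                     ∎)
  where
  open ≡-Reasoning
  inv : ∀ (c d : Colouring (suc m) k) v → (∀ u → u ≢ v → col c u ≡ col d u) →
    I (tabulate (col c)) ≡ I (tabulate (col d))
  inv c d v eq = subst (λ y → I (tabulate (col c)) ≡ I y) (sym updated)
    (locked (tabulate (col c)) (Valid-tabulate c) v (col d v) (subst Valid updated (Valid-tabulate d)))
    where
    at : ∀ u → col d u ≡ lookup (tabulate (col c) [ v ]≔ col d v) u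
    at u with u ≟ v
    ... | yes refl = sym (lookup∘update u (tabulate (col c)) (col d u))
    ... | no u≢v   = sym (trans (lookup∘update′ u≢v (tabulate (col c)) (col d v))
                                (trans (lookup∘tabulate (col c) u) (eq u u≢v)))
    updated : tabulate (col d) ≡ tabulate (col c) [ v ]≔ col d v
    updated = trans (tabulate-cong at) (tabulate∘lookup _)

-- Up to rotation a strong 3-colouring of the 4-cycle reads a b a c. Each a sees both other colours,
-- and b and c are unique, so nothing can move and the colour of vertex 0 is an invariant.
disconnected-4-3 : ¬ SConnected (Cycle 4) 3
disconnected-4-3 = disconnected-by I (toWitness {a? = locked? I} _) w x
  (toWitness {a? = valid? w} _) (toWitness {a? = valid? x} _) λ ()
  where
  I : Word 4 3 → ℕ
  I = toℕ ∘ head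
  w x : Word 4 3
  w = 0F ∷ 1F ∷ 0F ∷ 2F ∷ []
  x = 1F ∷ 0F ∷ 1F ∷ 2F ∷ []

-- A strong 4-colouring of C₅ repeats one colour, on the two neighbours of a vertex
-- v.  The pairing of the colours in which v and its neighbours are partners is the
-- one with three edges between partners (the others have one), and no move changes it.
disconnected-5-4 : ¬ SConnected (Cycle 5) 4
disconnected-5-4 = disconnected-by I (toWitness {a? = locked? I} _) w x
  (toWitness {a? = valid? w} _) (toWitness {a? = valid? x} _) λ ()
  where
  partner : Fin 4 → Fin 4
  partner 0F = 1F
  partner 1F = 0F
  partner 2F = 3F
  partner 3F = 2F
  I : Word 5 4 → ℕ
  I w = length (filter (λ v → lookup w (prev v) ≟ partner (lookup w v)) (allFin 5))
  w x : Word 5 4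
  w = 0F ∷ 1F ∷ 0F ∷ 2F ∷ 3F ∷ []
  x = 0F ∷ 2F ∷ 0F ∷ 1F ∷ 3F ∷ []

disconnected-3 : ∀ j → ¬ SConnected (Cycle (5 + j)) 3
disconnected-3 j conn =
  let c , d , ne = different j
  in ne (reach-invariant (ascents ∘ col) ascents-invariant (conn c d))
  where
  Different : ℕ → Set
  Different j = ∃₂ λ (c d : Colouring (5 + j) 3) → ascents (col c) ≢ ascents (col d)

  -- The pairs wind in opposite directions: 4 ascents against 1, and 6 against 0. Two base lengths
  -- are given because `grow` lengthens the cycle by two.
  w₅ x₅ : Word 5 3
  w₅ = 0F ∷ 1F ∷ 2F ∷ 0F ∷ 1F ∷ []
  x₅ = 0F ∷ 2F ∷ 1F ∷ 0F ∷ 2F ∷ []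
  w₆ x₆ : Word 6 3
  w₆ = 0F ∷ 1F ∷ 2F ∷ 0F ∷ 1F ∷ 2F ∷ []
  x₆ = 0F ∷ 2F ∷ 1F ∷ 0F ∷ 2F ∷ 1F ∷ []

  different : ∀ j → Different j
  different 0 = colouring w₅ (toWitness {a? = valid? w₅} _) , colouring x₅ (toWitness {a? = valid? x₅} _) , λ ()
  different 1 = colouring w₆ (toWitness {a? = valid? w₆} _) , colouring x₆ (toWitness {a? = valid? x₆} _) , λ ()
  different (suc (suc j)) =
    let c , d , ne = different j
        c' , ec = grow c
        d' , ed = grow d
    in c' , d' , λ e → ne (ℕ.suc-injective (trans (sym ec) (trans e ed)))

-- The induction on the length of the cycle

-- With n = 6 + j and k = 4 + i, the bound k < n reads `i ≤ suc j`. The descent is diagonal while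
-- both are positive, then along `i = 0`.
connected : ∀ j i → i ≤ suc j → SConnected (Cycle (6 + j)) (4 + i)
connected zero    zero          _ = connected-6-4
connected zero    (suc zero)    _ = connected-6-5
connected zero    (suc (suc i)) (s≤s ())
connected (suc j) zero          _ =
  connected-extend-vertex (ℕ.m≤m+n 4 0) (ℕ.m≤m+n 5 (2 + j)) (connected j zero z≤n)
connected (suc j) (suc i)       (s≤s i≤j) =
  connected-extend-both (ℕ.m≤m+n 4 (suc i)) (s≤s (s≤s (s≤s (s≤s (s≤s (s≤s i≤j)))))) (connected j i i≤j)

theorem4p5 : (n k : ℕ) → 3 ≤ n → 1 ≤ k → ChromaticAtMost (Cycle n) k → suc k ≤ n →
    SConnected (Cycle n) k ⇔ ((4 ≤ k) × (6 ≤ n) × (suc k ≤ n))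
theorem4p5 n k 3≤n 1≤k χ k<n = mk⇔ (λ conn → let 4≤k , 6≤n = necessary n k 3≤n 1≤k χ k<n conn in 4≤k , 6≤n , k<n)
                                   (λ (4≤k , 6≤n , _) → sufficient n k 4≤k 6≤n k<n)
  where
  necessary : ∀ n k → 3 ≤ n → 1 ≤ k → ChromaticAtMost (Cycle n) k → suc k ≤ n →
    SConnected (Cycle n) k → 4 ≤ k × 6 ≤ n
  necessary (suc (suc n)) 1 _ _ (c , p) _ _ with c 0F | c 1F | p 0F 1F (inj₁ (inj₁ refl))
  ... | 0F | 0F | ne = contradiction refl ne
  necessary (suc (suc n)) 2 _ _ χ _ conn = contradiction conn (disconnected-2 χ)
  necessary 4 3 _ _ _ _ conn = contradiction conn disconnected-4-3
  necessary (suc (suc (suc (suc (suc j))))) 3 _ _ _ _ conn = contradiction conn (disconnected-3 j)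
  necessary 5 4 _ _ _ _ conn = contradiction conn disconnected-5-4
  necessary n@(suc (suc (suc (suc (suc (suc j)))))) (suc (suc (suc (suc i)))) _ _ _ _ _ =
    ℕ.m≤m+n 4 i , ℕ.m≤m+n 6 j
  necessary 3 3 _ _ _ (s≤s (s≤s (s≤s ())))
  necessary 4 (suc (suc (suc (suc _)))) _ _ _ (s≤s (s≤s (s≤s (s≤s ()))))
  necessary 3 (suc (suc (suc (suc _)))) _ _ _ (s≤s (s≤s (s≤s ())))
  necessary 5 (suc (suc (suc (suc (suc _))))) _ _ _ (s≤s (s≤s (s≤s (s≤s (s≤s ())))))
  necessary 1 _ (s≤s ())
  necessary 2 _ (s≤s (s≤s ()))

  sufficient : ∀ n k → 4 ≤ k → 6 ≤ n → k < n → SConnected (Cycle n) k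
  sufficient _ _ (s≤s (s≤s (s≤s (s≤s (z≤n {i}))))) (s≤s (s≤s (s≤s (s≤s (s≤s (s≤s (z≤n {j})))))))
         (s≤s (s≤s (s≤s (s≤s (s≤s i≤1+j))))) = connected j i i≤1+j
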